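{- Let $\kappa$ be a regular cardinal and $A$ a $\kappa$-additive complete atomic modal algebra. Then $\tau_A:A\to G(F(A))$, $\tau_A(x)=\{a\in\mathrm{At}(A)\mid a\leq x\}$, is an isomorphism of complete modal algebras; in particular, for every $x\in A$, $$\{a\in\mathrm{At}(A)\mid a\leq\Diamond x\}=\bigcap_{X\subseteq A,\ |X|<\kappa}R(X)^{ -1}\big[\{a\in\mathrm{At}(A)\mid a\leq x\}\big].$$
   Context: A modal algebra is a Boolean algebra $A$ with a unary operation $\Diamond$ satisfying $\Diamond 0=0$ and $\Diamond(x\vee y)=\Diamond x\vee\Diamond y$; complete/atomic refer to the Boolean reduct (atomic: every non-zero element is the join of atoms below it); $\mathrm{At}(A)$ is the set of atoms; $\kappa$-additive means $\Diamond\bigvee X=\bigvee_{x\in X}\Diamond x$ for $|X|<\kappa$. A homomorphism of complete modal algebras is a Boolean homomorphism preserving all joins and meets and commuting with $\Diamond$. For $X\subseteq A$, $R(X)$ is the relation on $\mathrm{At}(A)$ with $a\,R(X)\,c\iff a\leq\bigwedge\{\Diamond x\mid x\in X,\ c\leq x\}$ (empty meet $=1$); $F(A)=\langle\mathrm{At}(A),\{R(X)\mid X\subseteq A,|X|<\kappa\}\rangle$. For a relation $R$ and a set $Y$, $R^{ -1}[Y]=\{w\mid wRy\text{ for some }y\in Y\}$. For a multi-relational Kripke frame $M=\langle W,S\rangle$, $G(M)$ is the powerset Boolean algebra $\mathcal P(W)$ with $\Diamond_MY=\bigcap_{R\in S}R^{ -1}[Y]$. -}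

module Defs where

open import Algebra.Core using (Op₁; Op₂)
open import Data.Empty.Polymorphic using () renaming (⊥ to ∅ₚ)
open import Data.Nat.Base using (ℕ)
open import Data.Product.Base using (Σ; Σ-syntax; ∃; ∃-syntax; _×_; _,_; proj₁; proj₂; swap)
open import Data.Sum.Base using (_⊎_; inj₁; inj₂)
open import Data.Unit.Polymorphic using () renaming (⊤ to Uₚ)
open import Function.Base using (_∘_; id)
open import Function.Bundles using (Injection; _↣_; _⇔_; Equivalence)
open import Function.Definitions using (Congruent; Bijective)
open import Induction.WellFounded using (WellFounded)
open import Level using (Level; _⊔_; suc; Lift; lift; lower)
open import Relation.Binary.Bundles using (Setoid)
open import Relation.Binary.Core using (Rel)
open import Relation.Binary.Definitions using (_Respects_; _Respects₂_)
open import Relation.Binary.Lattice.Structures using (IsBooleanAlgebra)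
open import Relation.Binary.PropositionalEquality using (_≡_; setoid)
open import Relation.Binary.Structures using (IsStrictTotalOrder)
import Relation.Binary.Construct.On as On
open import Relation.Nullary.Negation using (¬_)
open import Relation.Unary using (Pred; _∈_; _∉_; _⊆_; _≐_; _∪_; _∩_)

private
  variable
    a ℓ b ℓ′ p q r s k : Level

-- Sets are setoids, so a subset is a predicate closed under _≈_.
record Subset (S : Setoid a ℓ) p : Set (a ⊔ ℓ ⊔ suc p) where
  constructor subset
  open Setoid S
  field
    mem  : Pred Carrier p
    resp : mem Respects _≈_

open Subset public

image : (S : Setoid a ℓ) (T : Setoid b ℓ′) →
        (Setoid.Carrier S → Setoid.Carrier T) → Subset S p → Subset T (a ⊔ ℓ′ ⊔ p)
image S T f X = subset
  (λ y → ∃[ x ] x ∈ mem X × y ≈ f x)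
  (λ y≈z (x , x∈X , y≈fx) → x , x∈X , trans (sym y≈z) y≈fx)
  where open Setoid T

subsetSetoid : (S : Setoid a ℓ) → Subset S p → Setoid (a ⊔ p) ℓ
subsetSetoid S X = On.setoid {B = ∃ (mem X)} S proj₁

powersetSetoid : (S : Setoid a ℓ) (p : Level) → Setoid (a ⊔ ℓ ⊔ suc p) (a ⊔ p)
powersetSetoid S p = record
  { Carrier       = Subset S p
  ; _≈_           = λ X Y → mem X ≐ mem Y
  ; isEquivalence = record
    { refl  = id , id
    ; sym   = swap
    ; trans = λ (f , g) (h , i) → (λ x → h (f x)) , (λ x → g (i x))
    }
  }

-- |S| < |T|, for setoids counted up to their equality.
infix 4 _≺_
_≺_ : Setoid a ℓ → Setoid b ℓ′ → Set (a ⊔ ℓ ⊔ b ⊔ ℓ′)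
S ≺ T = Injection S T × ¬ Injection T S

-- An infinite cardinal is an infinite initial ordinal; it is regular if
-- it equals its cofinality, i.e. no cofinal subset has smaller cardinality.
record RegularCardinal k : Set (suc k) where
  infix 4 _<_
  field
    Ordinal            : Set k
    _<_                : Rel Ordinal k
    isStrictTotalOrder : IsStrictTotalOrder _≡_ _<_
    <-wellFounded      : WellFounded _<_

  cardinal : Setoid k k
  cardinal = setoid Ordinal

  segment : Ordinal → Setoid k k
  segment α = On.setoid {B = ∃ (_< α)} cardinal proj₁

  Cofinal : Pred Ordinal k → Set k
  Cofinal C = ∀ α → ∃[ β ] β ∈ C × (α < β ⊎ α ≡ β)

  field
    initial  : ∀ α → ¬ Injection cardinal (segment α)
    infinite : ℕ ↣ Ordinal
    regular  : ∀ (C : Pred Ordinal k) → Cofinal C →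
               ¬ (On.setoid {B = ∃ C} cardinal proj₁ ≺ cardinal)

record RawModalAlgebra c ℓ₁ ℓ₂ : Set (suc (c ⊔ ℓ₁ ⊔ ℓ₂)) where
  infix  4 _≤_
  infixr 6 _∨_
  infixr 7 _∧_
  field
    base : Setoid c ℓ₁
  open Setoid base public
  field
    _≤_ : Rel Carrier ℓ₂
    _∨_ : Op₂ Carrier
    _∧_ : Op₂ Carrier
    ∁   : Op₁ Carrier
    ⊤   : Carrier
    ⊥   : Carrier
    ◇   : Op₁ Carrier

  -- Under excluded middle every predicate is equivalent to one at this
  -- level, so 𝒫 contains all subsets.
  𝒫 : Set (suc (c ⊔ ℓ₁ ⊔ ℓ₂))
  𝒫 = Subset base (c ⊔ ℓ₁ ⊔ ℓ₂)

  IsJoin : Pred Carrier p → Pred Carrier (c ⊔ ℓ₂ ⊔ p)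
  IsJoin X s = (∀ {x} → x ∈ X → x ≤ s) × (∀ u → (∀ {x} → x ∈ X → x ≤ u) → s ≤ u)

  IsMeet : Pred Carrier p → Pred Carrier (c ⊔ ℓ₂ ⊔ p)
  IsMeet X m = (∀ {x} → x ∈ X → m ≤ x) × (∀ l → (∀ {x} → x ∈ X → l ≤ x) → l ≤ m)

  IsAtom : Pred Carrier (c ⊔ ℓ₁ ⊔ ℓ₂)
  IsAtom x = ¬ (x ≈ ⊥) × (∀ y → y ≤ x → y ≈ ⊥ ⊎ y ≈ x)

  At : Setoid (c ⊔ ℓ₁ ⊔ ℓ₂) ℓ₁
  At = On.setoid {B = ∃ IsAtom} base proj₁

record IsCompleteModalAlgebra {c ℓ₁ ℓ₂} (A : RawModalAlgebra c ℓ₁ ℓ₂) :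
                              Set (suc (c ⊔ ℓ₁ ⊔ ℓ₂)) where
  open RawModalAlgebra A
  field
    isBooleanAlgebra : IsBooleanAlgebra _≈_ _≤_ _∨_ _∧_ ∁ ⊤ ⊥
    ◇-cong           : Congruent _≈_ _≈_ ◇
    ◇-⊥              : ◇ ⊥ ≈ ⊥
    ◇-∨              : ∀ x y → ◇ (x ∨ y) ≈ ◇ x ∨ ◇ y
    joins            : ∀ (X : 𝒫) → ∃ (IsJoin (mem X))
    meets            : ∀ (X : 𝒫) → ∃ (IsMeet (mem X))

  open IsBooleanAlgebra isBooleanAlgebra public
    using (≤-respˡ-≈; ≤-respʳ-≈)
    renaming (trans to ≤-trans)

record CompleteModalAlgebra c ℓ₁ ℓ₂ : Set (suc (c ⊔ ℓ₁ ⊔ ℓ₂)) where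
  field
    raw                    : RawModalAlgebra c ℓ₁ ℓ₂
    isCompleteModalAlgebra : IsCompleteModalAlgebra raw
  open RawModalAlgebra raw public
  open IsCompleteModalAlgebra isCompleteModalAlgebra public

  ⋁ : 𝒫 → Carrier
  ⋁ X = proj₁ (joins X)

  ⋀ : 𝒫 → Carrier
  ⋀ X = proj₁ (meets X)

  Atomic : Set (c ⊔ ℓ₁ ⊔ ℓ₂)
  Atomic = ∀ x → ¬ (x ≈ ⊥) → IsJoin (λ y → IsAtom y × y ≤ x) x

  ∣_∣<_ : 𝒫 → RegularCardinal k → Set (c ⊔ ℓ₁ ⊔ ℓ₂ ⊔ k)
  ∣ X ∣< κ = subsetSetoid base X ≺ RegularCardinal.cardinal κ

  Additive : RegularCardinal k → Set (suc (c ⊔ ℓ₁ ⊔ ℓ₂) ⊔ k)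
  Additive κ = ∀ (X : 𝒫) → ∣ X ∣< κ → ◇ (⋁ X) ≈ ⋁ (image base base ◇ X)

  above : 𝒫 → Carrier → 𝒫
  above X c = subset
    (λ x → x ∈ mem X × c ≤ x)
    (λ x≈y (x∈X , c≤x) → resp X x≈y x∈X , ≤-respʳ-≈ x≈y c≤x)

  R : 𝒫 → Rel (Setoid.Carrier At) ℓ₂
  R X (a , _) (c , _) = a ≤ ⋀ (image base base ◇ (above X c))

  R-resp : ∀ X → R X Respects₂ Setoid._≈_ At
  R-resp X =
    (λ {a} {c} {d} c≈d aRc → ≤-trans aRc
      (proj₂ (meets (image base base ◇ (above X (proj₁ d)))) .proj₂ _
        (λ (x , (x∈X , d≤x) , y≈◇x) →
          proj₂ (meets (image base base ◇ (above X (proj₁ c)))) .proj₁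
            (x , (x∈X , ≤-respˡ-≈ (sym c≈d) d≤x) , y≈◇x)))) ,
    (λ a≈b aRc → ≤-respˡ-≈ a≈b aRc)

module _ {c ℓ₁ ℓ₂ d ℓ₃ ℓ₄} (A : RawModalAlgebra c ℓ₁ ℓ₂) (B : RawModalAlgebra d ℓ₃ ℓ₄) where
  private
    module A = RawModalAlgebra A
    module B = RawModalAlgebra B

  record IsCompleteModalHomomorphism (f : A.Carrier → B.Carrier) :
           Set (suc (c ⊔ ℓ₁ ⊔ ℓ₂) ⊔ d ⊔ ℓ₃ ⊔ ℓ₄) where
    field
      cong    : Congruent A._≈_ B._≈_ f
      ∨-homo  : ∀ x y → f (x A.∨ y) B.≈ f x B.∨ f y
      ∧-homo  : ∀ x y → f (x A.∧ y) B.≈ f x B.∧ f y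
      ∁-homo  : ∀ x → f (A.∁ x) B.≈ B.∁ (f x)
      ⊤-homo  : f A.⊤ B.≈ B.⊤
      ⊥-homo  : f A.⊥ B.≈ B.⊥
      ⋁-homo  : ∀ (X : A.𝒫) {s} → A.IsJoin (mem X) s →
                B.IsJoin (mem (image A.base B.base f X)) (f s)
      ⋀-homo  : ∀ (X : A.𝒫) {m} → A.IsMeet (mem X) m →
                B.IsMeet (mem (image A.base B.base f X)) (f m)
      ◇-homo  : ∀ x → f (A.◇ x) B.≈ B.◇ (f x)

  record IsCompleteModalIsomorphism (f : A.Carrier → B.Carrier) :
           Set (suc (c ⊔ ℓ₁ ⊔ ℓ₂) ⊔ d ⊔ ℓ₃ ⊔ ℓ₄) where
    field
      isHomomorphism : IsCompleteModalHomomorphism f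
      bijective      : Bijective A._≈_ B._≈_ f

record KripkeFrame w ℓ r s : Set (suc (w ⊔ ℓ ⊔ r ⊔ s)) where
  field
    worlds    : Setoid w ℓ
  open Setoid worlds public
  field
    relations : Pred (Rel Carrier r) s
    respects  : ∀ {R} → R ∈ relations → R Respects₂ _≈_

infix 8 _⁻¹[_]
_⁻¹[_] : {W : Set a} → Rel W r → Pred W p → Pred W (a ⊔ r ⊔ p)
(R ⁻¹[ Y ]) w = ∃[ y ] R w y × y ∈ Y

-- The predicate level of the powerset is chosen large enough for it to be
-- closed under ◇; classically it does not affect what subsets there are.
-- G M is only a raw structure: the Boolean laws need excluded middle, and ◇
-- need not be additive for an arbitrary frame.
G : ∀ {w ℓ r s} → KripkeFrame w ℓ r s →
    RawModalAlgebra (ℓ ⊔ suc (w ⊔ suc r ⊔ s)) (w ⊔ suc r ⊔ s) (w ⊔ suc r ⊔ s)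
G {w} {ℓ} {r} {s} M = record
  { base = powersetSetoid worlds (w ⊔ suc r ⊔ s)
  ; _≤_  = λ Y Z → mem Y ⊆ mem Z
  ; _∨_  = λ Y Z → subset (mem Y ∪ mem Z)
             (λ { x≈y (inj₁ x∈Y) → inj₁ (resp Y x≈y x∈Y)
                ; x≈y (inj₂ x∈Z) → inj₂ (resp Z x≈y x∈Z) })
  ; _∧_  = λ Y Z → subset (mem Y ∩ mem Z)
             (λ x≈y (x∈Y , x∈Z) → resp Y x≈y x∈Y , resp Z x≈y x∈Z)
  ; ∁    = λ Y → subset (_∉ mem Y) (λ x≈y x∉Y y∈Y → x∉Y (resp Y (sym x≈y) y∈Y))
  ; ⊤    = subset (λ _ → Uₚ) _
  ; ⊥    = subset (λ _ → ∅ₚ) (λ _ ())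
  ; ◇    = λ Y → subset
             (λ w → ∀ R → R ∈ relations → w ∈ R ⁻¹[ mem Y ])
             (λ w≈v w∈◇Y R R∈S →
               let y , wRy , y∈Y = w∈◇Y R R∈S
               in  y , proj₂ (respects R∈S) w≈v wRy , y∈Y)
  }
  where open KripkeFrame M

module _ {c ℓ₁ ℓ₂ k} (κ : RegularCardinal k) (A : CompleteModalAlgebra c ℓ₁ ℓ₂) where
  open CompleteModalAlgebra A

  -- Relations are identified when they hold of the same pairs.
  F : KripkeFrame (c ⊔ ℓ₁ ⊔ ℓ₂) ℓ₁ ℓ₂ (k ⊔ suc (c ⊔ ℓ₁ ⊔ ℓ₂))
  F = record
    { worlds    = At
    ; relations = λ Q → Σ[ X ∈ 𝒫 ] ∣ X ∣< κ × (∀ a c → Q a c ⇔ R X a c)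
    ; respects  = λ (X , _ , Q⇔R) →
        (λ {a} {c} {d} c≈d aQc → from (Q⇔R _ _) (proj₁ (R-resp X) {a} {c} {d} c≈d (to (Q⇔R _ _) aQc))) ,
        (λ {c} {a} {b} a≈b aQc → from (Q⇔R _ _) (proj₂ (R-resp X) {c} {a} {b} a≈b (to (Q⇔R _ _) aQc)))
    }
    where open Equivalence using (to; from)

  atomsBelow : Carrier → Pred (Setoid.Carrier At) ℓ₂
  atomsBelow x (a , _) = a ≤ x

  -- Lift only raises the predicate level to that used by G.
  τ : Carrier → RawModalAlgebra.Carrier (G F)
  τ x = subset (λ a → Lift (k ⊔ suc (c ⊔ ℓ₁ ⊔ ℓ₂)) (a ∈ atomsBelow x))
               (λ a≈b a≤x → lift (≤-respˡ-≈ a≈b (lower a≤x)))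

{-# OPTIONS --safe #-}

-- Under τ each x ∈ A becomes the set of atoms below it; since A is atomic and
-- atoms are completely join-prime, this is a complete Boolean isomorphism onto
-- the powerset. For ◇, let a be an atom with a ≤ ◇ x and let |X| < κ. If no atom
-- c ≤ x satisfied a R(X) c, the subset X′ = {y ∈ X ∣ a ≰ ◇ y} would cover every
-- atom below x, so a ≤ ◇ x ≤ ◇ ⋁ X′ = ⋁ ◇ X′ by κ-additivity, and
-- join-primeness would give a ≤ ◇ y for some y ∈ X′. Conversely, X = {x} already
-- forces a ≤ ◇ x.

module Submission where

open import Defs
open import Axiom.ExcludedMiddle using (ExcludedMiddle)
open import Data.Empty using (⊥-elim)
open import Data.Product.Base using (Σ-syntax; ∃; ∃-syntax; _×_; _,_; proj₁; proj₂)
open import Data.Sum.Base using (_⊎_; inj₁; inj₂; [_,_]; [_,_]′)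
open import Function.Base using (_∘_; id; case_of_)
open import Function.Bundles using (Injection; Equivalence)
open import Function.Consequences.Setoid using (strictlySurjective⇒surjective)
open import Function.Construct.Composition using (injection)
open import Function.Construct.Identity using (⇔-id)
open import Level using (Level; _⊔_; Lift; lift; lower)
open import Relation.Binary.Bundles using (Setoid)
open import Relation.Binary.Lattice.Structures using (IsBooleanAlgebra)
open import Relation.Binary.PropositionalEquality using (_≡_; refl)
open import Relation.Nullary.Decidable.Core using (yes; no; True; toWitness; fromWitness; decidable-stable)
open import Relation.Nullary.Negation.Core using (¬_)
open import Relation.Unary using (Pred; _∈_; _⊆_; _≐_; ⋂)

private
  variable
    a b ℓ ℓ′ p q r s k w : Level

≺-respˡ-↣ : {S : Setoid a ℓ} {T : Setoid b ℓ′} {U : Setoid p q} →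
            Injection S T → T ≺ U → S ≺ U
≺-respˡ-↣ S↣T (T↣U , U↣̸T) = injection S↣T T↣U , λ U↣S → U↣̸T (injection U↣S S↣T)

module Classical (em : ∀ {ℓ} → ExcludedMiddle ℓ) where

  by-contradiction : {P : Set p} → ¬ ¬ P → P
  by-contradiction = decidable-stable em

  -- True em lies in the lowest universe, so excluded middle yields propositional resizing.
  Resize : ∀ q → Set p → Set q
  Resize q P = Lift q (True (em {P = P}))

  resize : {P : Set p} → P → Resize q P
  resize x = lift (fromWitness x)

  unresize : {P : Set p} → Resize q P → P
  unresize = toWitness ∘ lower

  -- The powerset of a frame as a complete Boolean algebra.

  module Powerset (M : KripkeFrame w ℓ r s) where
    open KripkeFrame M using (worlds)
    open RawModalAlgebra (G M)

    isBooleanAlgebra : IsBooleanAlgebra _≈_ _≤_ _∨_ _∧_ ∁ ⊤ ⊥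
    isBooleanAlgebra = record
      { isHeytingAlgebra = record
        { isBoundedLattice = record
          { isLattice = record
            { isPartialOrder = record
              { isPreorder = record
                { isEquivalence = isEquivalence
                ; reflexive     = proj₁
                ; trans         = λ f g x → g (f x)
                }
              ; antisym = _,_
              }
            ; supremum = λ _ _ → inj₁ , inj₂ , λ _ f g → [ f , g ]
            ; infimum  = λ _ _ → proj₁ , proj₂ , λ _ f g x → f x , g x
            }
          ; maximum = _
          ; minimum = λ _ ()
          }
        -- `X ⇨ Y` unfolds to `∁ X ∨ Y`, so residuation has to decide membership in `X`; this is the
        -- one Boolean law here that is classical.
        ; exponential = λ Z X Y →
            (λ f {w} w∈Z → case em {P = w ∈ mem X} of λ where
              (yes w∈X) → inj₂ (f (w∈Z , w∈X))
              (no  w∉X) → inj₁ w∉X) ,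
            λ g (w∈Z , w∈X) → [ (λ w∉X → ⊥-elim (w∉X w∈X)) , id ] (g w∈Z)
        }
      }

    -- The union quantifies over subsets, one universe above the predicates that make up `G M`;
    -- `Resize` brings it back down.
    joins : (X : 𝒫) → ∃ (IsJoin (mem X))
    joins X =
      subset (λ w → Resize _ (∃[ Y ] Y ∈ mem X × w ∈ mem Y))
        (λ v≈w v∈⋃ → let Y , Y∈X , v∈Y = unresize v∈⋃ in
          resize (Y , Y∈X , resp Y v≈w v∈Y)) ,
      (λ Y∈X w∈Y → resize (_ , Y∈X , w∈Y)) ,
      λ _ ub w∈⋃ → let _ , Y∈X , w∈Y = unresize w∈⋃ in ub Y∈X w∈Y

    meets : (X : 𝒫) → ∃ (IsMeet (mem X))
    meets X =
      subset (λ w → Resize _ (∀ Y → Y ∈ mem X → w ∈ mem Y))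
        (λ v≈w v∈⋂ → resize λ Y Y∈X → resp Y v≈w (unresize v∈⋂ Y Y∈X)) ,
      (λ Y∈X w∈⋂ → unresize w∈⋂ _ Y∈X) ,
      λ _ lb w∈L → resize λ _ Y∈X → lb Y∈X w∈L

    ◇-mono : ∀ {Y Z} → Y ≤ Z → ◇ Y ≤ ◇ Z
    ◇-mono Y≤Z w∈◇Y R R∈S = let y , wRy , y∈Y = w∈◇Y R R∈S in y , wRy , Y≤Z y∈Y

    ◇-cong : ∀ {Y Z} → Y ≈ Z → ◇ Y ≈ ◇ Z
    ◇-cong {Y} {Z} (Y≤Z , Z≤Y) = ◇-mono {Y} {Z} Y≤Z , ◇-mono {Z} {Y} Z≤Y

  -- Atoms of an atomic complete modal algebra.

  module Atoms {c ℓ₁ ℓ₂} (A : CompleteModalAlgebra c ℓ₁ ℓ₂)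
               (atomic : CompleteModalAlgebra.Atomic A) where
    open CompleteModalAlgebra A renaming (refl to ≈-refl)
    open IsBooleanAlgebra isBooleanAlgebra public
      using (transpose-⇨; transpose-∧; ∨-least; x≤x∨y; y≤x∨y; ∧-greatest; x∧y≤x; x∧y≤y;
             minimum; maximum; antisym)
      renaming (refl to ≤-refl; reflexive to ≤-reflexive)

    ◇-mono : ∀ {x y} → x ≤ y → ◇ x ≤ ◇ y
    ◇-mono {x} {y} x≤y =
      ≤-trans (x≤x∨y (◇ x) (◇ y))
        (≤-reflexive (trans (sym (◇-∨ x y))
          (◇-cong (antisym (∨-least x≤y ≤-refl) (y≤x∨y x y)))))

    atom-≰⊥ : ∀ {a} → IsAtom a → ¬ (a ≤ ⊥)
    atom-≰⊥ (a≉⊥ , _) a≤⊥ = a≉⊥ (antisym a≤⊥ (minimum _))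

    ≤∁⇒≰ : ∀ {a x} → IsAtom a → a ≤ ∁ x → ¬ (a ≤ x)
    ≤∁⇒≰ {a} {x} a-atom a≤∁x a≤x = atom-≰⊥ a-atom
      (≤-trans (∧-greatest ≤-refl a≤x)
        -- `∁ x ∨ ⊥` is `x ⇨ ⊥`, so transposing yields `a ∧ x ≤ ⊥`.
        (transpose-∧ (≤-trans a≤∁x (x≤x∨y (∁ x) ⊥))))

    -- By minimality `x ∧ a` is `⊥` or `a`, and the latter would put `a` below `x`. Complementing
    -- the atom gives a bound that does not depend on `x`, as join-primeness requires.
    ≰⇒≤∁ : ∀ {a x} → IsAtom a → ¬ (a ≤ x) → x ≤ ∁ a
    ≰⇒≤∁ {a} {x} (_ , a-min) a≰x with a-min (x ∧ a) (x∧y≤y x a)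
    ... | inj₁ x∧a≈⊥ = ≤-trans (transpose-⇨ (≤-reflexive x∧a≈⊥)) (∨-least ≤-refl (minimum _))
    ... | inj₂ x∧a≈a = ⊥-elim (a≰x (≤-trans (≤-reflexive (sym x∧a≈a)) (x∧y≤x x a)))

    ≰⇒atom≤∁ : ∀ {a x} → IsAtom a → ¬ (a ≤ x) → a ≤ ∁ x
    ≰⇒atom≤∁ {a} {x} (_ , a-min) a≰x with a-min (a ∧ x) (x∧y≤x a x)
    ... | inj₁ a∧x≈⊥ = ≤-trans (transpose-⇨ (≤-reflexive a∧x≈⊥)) (∨-least ≤-refl (minimum _))
    ... | inj₂ a∧x≈a = ⊥-elim (a≰x (≤-trans (≤-reflexive (sym a∧x≈a)) (x∧y≤y a x)))

    -- If no member of `P` were above `a`, then `∁ a` would bound `P`, hence also `s`, giving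
    -- `a ≤ ∁ a`.
    atom-join-prime : ∀ {P : Pred Carrier p} {a s} → IsAtom a → IsJoin P s → a ≤ s →
                      ∃[ x ] x ∈ P × a ≤ x
    atom-join-prime a-atom (_ , least) a≤s = by-contradiction λ none →
      ≤∁⇒≰ a-atom
        (≤-trans a≤s (least _ λ x∈P → ≰⇒≤∁ a-atom λ a≤x → none (_ , x∈P , a≤x))) ≤-refl

    atom-∨-prime : ∀ {a} x y → IsAtom a → a ≤ x ∨ y → a ≤ x ⊎ a ≤ y
    atom-∨-prime x y a-atom a≤x∨y
      with atom-join-prime {P = λ z → z ≡ x ⊎ z ≡ y} a-atom
             ((λ { (inj₁ refl) → x≤x∨y x y ; (inj₂ refl) → y≤x∨y x y }) ,
              λ _ ub → ∨-least (ub (inj₁ refl)) (ub (inj₂ refl)))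
             a≤x∨y
    ... | _ , inj₁ refl , a≤x = inj₁ a≤x
    ... | _ , inj₂ refl , a≤y = inj₂ a≤y

    -- Here `y` bounds the atoms whose join is `x`. Atomicity speaks of non-zero elements only,
    -- hence the case split.
    atomwise-≤ : ∀ {x y} → (∀ {a} → IsAtom a → a ≤ x → a ≤ y) → x ≤ y
    atomwise-≤ {x} {y} x⊆y with em {P = x ≈ ⊥}
    ... | yes x≈⊥ = ≤-trans (≤-reflexive x≈⊥) (minimum y)
    ... | no  x≉⊥ = proj₂ (atomic x x≉⊥) y λ (a-atom , a≤x) → x⊆y a-atom a≤x

    ｛_｝ : Carrier → 𝒫
    ｛ x ｝ = subset (λ y → Lift (c ⊔ ℓ₁ ⊔ ℓ₂) (y ≈ x))
                     (λ y≈z (lift y≈x) → lift (trans (sym y≈z) y≈x))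

    -- Small subsets and the relations they define.

    module _ (κ : RegularCardinal k) where
      open RegularCardinal κ using (infinite)

      ⊆-∣< : (X Y : 𝒫) → mem X ⊆ mem Y → ∣ Y ∣< κ → ∣ X ∣< κ
      ⊆-∣< X Y X⊆Y = ≺-respˡ-↣ record
        { to = λ (x , x∈X) → x , X⊆Y x∈X ; cong = id ; injective = id }

      -- Infinity of `κ` serves twice: it supplies a point to map `x` to, and an injection from `κ`
      -- into a single point would identify the images of 0 and 1.
      ｛｝-∣< : ∀ x → ∣ ｛ x ｝ ∣< κ
      ｛｝-∣< x =
        record { to = λ _ → Injection.to infinite 0
               ; cong = λ _ → refl
               ; injective = λ { {_ , lift y≈x} {_ , lift z≈x} _ → trans y≈x (sym z≈x) } } ,
        λ κ↣｛x｝ →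
          let i = λ n → Injection.to κ↣｛x｝ (Injection.to infinite n)
          in case Injection.injective infinite {0} {1}
                  (Injection.injective κ↣｛x｝
                    (trans (lower (proj₂ (i 0))) (sym (lower (proj₂ (i 1)))))) of λ ()

      ≤◇⇒R : Additive κ → ∀ {x} X → ∣ X ∣< κ → ∀ {a} → a ∈ atomsBelow κ A (◇ x) →
             a ∈ R X ⁻¹[ atomsBelow κ A x ]
      ≤◇⇒R additive {x} X ∣X∣<κ {a , a-atom} a≤◇x = by-contradiction λ none →
        let
          X′ : 𝒫
          X′ = subset (λ y → y ∈ mem X × ¬ (a ≤ ◇ y))
                 (λ y≈z (y∈X , a≰◇y) → resp X y≈z y∈X ,
                    λ a≤◇z → a≰◇y (≤-respʳ-≈ (◇-cong (sym y≈z)) a≤◇z))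

          X′-covers : ∀ {b} → IsAtom b → b ≤ x → ∃[ y ] y ∈ mem X′ × b ≤ y
          X′-covers {b} b-atom b≤x = by-contradiction λ uncovered →
            -- An uncovered `b` is an `R X`-successor of `a`: any `y ∈ X` above `b` with `a ≰ ◇ y`
            -- would lie in `X′` and cover it.
            none ((b , b-atom) ,
              proj₂ (proj₂ (meets (image base base ◇ (above X b)))) a
                (λ (y , (y∈X , b≤y) , z≈◇y) → ≤-respʳ-≈ (sym z≈◇y)
                  (by-contradiction λ a≰◇y → uncovered (y , (y∈X , a≰◇y) , b≤y))) ,
              b≤x)

          x≤⋁X′ : x ≤ ⋁ X′
          x≤⋁X′ = atomwise-≤ λ b-atom b≤x →
            let _ , y∈X′ , b≤y = X′-covers b-atom b≤x
            in ≤-trans b≤y (proj₁ (proj₂ (joins X′)) y∈X′)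

          _ , (_ , (_ , a≰◇y) , z≈◇y) , a≤z =
            atom-join-prime a-atom (proj₂ (joins (image base base ◇ X′)))
              -- Additivity applies because `X′` inherits smallness from `X`.
              (≤-respʳ-≈ (additive X′ (⊆-∣< X′ X proj₁ ∣X∣<κ))
                (≤-trans a≤◇x (◇-mono x≤⋁X′)))
        in a≰◇y (≤-respʳ-≈ z≈◇y a≤z)

      -- Since `b ≤ x`, the element `◇ x` is itself a term of the meet that bounds `a`.
      R｛｝⇒≤◇ : ∀ {x a} → a ∈ R ｛ x ｝ ⁻¹[ atomsBelow κ A x ] → a ∈ atomsBelow κ A (◇ x)
      R｛｝⇒≤◇ {x} ((b , _) , aRb , b≤x) =
        ≤-trans aRb (proj₁ (proj₂ (meets (image base base ◇ (above ｛ x ｝ b))))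
          (x , (lift (≈-refl) , b≤x) , ≈-refl))

  -- The representation map and its image.

  module Representation {c ℓ₁ ℓ₂} (κ : RegularCardinal k) (A : CompleteModalAlgebra c ℓ₁ ℓ₂)
                        (additive : CompleteModalAlgebra.Additive A κ)
                        (atomic : CompleteModalAlgebra.Atomic A) where
    open CompleteModalAlgebra A renaming (refl to ≈-refl)
    open Atoms A atomic
    open Powerset (F κ A) using () renaming (◇-cong to ◇ᴳ-cong)
    private
      module G = RawModalAlgebra (G (F κ A))
      open Equivalence using (to; from)

    τᴬ : Carrier → G.Carrier
    τᴬ = τ κ A

    τ-mono : ∀ {x y} → x ≤ y → ∀ {a} → Lift ℓ (a ≤ x) → Lift ℓ (a ≤ y)
    τ-mono x≤y (lift a≤x) = lift (≤-trans a≤x x≤y)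

    τ-cong : ∀ {x y} → x ≈ y → τᴬ x G.≈ τᴬ y
    τ-cong x≈y = τ-mono (≤-reflexive x≈y) , τ-mono (≤-reflexive (sym x≈y))

    τ-cancel-≤ : ∀ {x y} → τᴬ x G.≤ τᴬ y → x ≤ y
    τ-cancel-≤ τx≤τy = atomwise-≤ λ a-atom a≤x → lower (τx≤τy {_ , a-atom} (lift a≤x))

    -- The preimage is the join of the atoms in `Y`. By join-primeness an atom below it is below
    -- some atom of `Y`, and comparable atoms coincide.
    τ-strictlySurjective : ∀ Y → ∃[ x ] τᴬ x G.≈ Y
    τ-strictlySurjective Y = ⋁ X ,
      (λ { {a , a-atom} (lift a≤⋁X) →
        let x , x∈X , a≤x = atom-join-prime a-atom (proj₂ (joins X)) a≤⋁X
            (b , b-atom) , b∈Y , b≈x = unresize x∈X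
        in case proj₂ b-atom a (≤-respʳ-≈ (sym b≈x) a≤x) of λ where
             (inj₁ a≈⊥) → ⊥-elim (proj₁ a-atom a≈⊥)
             (inj₂ a≈b) → resp Y (sym a≈b) b∈Y }) ,
      λ a∈Y → lift (proj₁ (proj₂ (joins X)) (resize (_ , a∈Y , ≈-refl)))
      where
      X : 𝒫
      -- Membership in `Y` lives above the level of `𝒫`, so it is resized before the join is taken.
      X = subset (λ x → Resize _ (∃[ a ] a ∈ mem Y × proj₁ a ≈ x))
            (λ x≈y x∈X → let a , a∈Y , a≈x = unresize x∈X in resize (a , a∈Y , trans a≈x x≈y))

    τ-∨-homo : ∀ x y → τᴬ (x ∨ y) G.≈ τᴬ x G.∨ τᴬ y
    τ-∨-homo x y =
      (λ { {_ , a-atom} (lift a≤x∨y) →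
        [ inj₁ ∘ lift , inj₂ ∘ lift ]′ (atom-∨-prime x y a-atom a≤x∨y) }) ,
      [ τ-mono (x≤x∨y x y) , τ-mono (y≤x∨y x y) ]

    τ-◇-homo : ∀ x → τᴬ (◇ x) G.≈ G.◇ (τᴬ x)
    τ-◇-homo x =
      (λ { {a} (lift a≤◇x) Q (X , ∣X∣<κ , Q⇔R) →
        let b , aRb , b≤x = ≤◇⇒R κ additive X ∣X∣<κ {a} a≤◇x
        in b , from (Q⇔R a b) aRb , lift b≤x }) ,
      λ {a} a∈◇τx →
        let b , aRb , lift b≤x = a∈◇τx (R ｛ x ｝) (｛ x ｝ , ｛｝-∣< κ x , λ _ _ → ⇔-id _)
        in lift (R｛｝⇒≤◇ κ {a = a} (b , aRb , b≤x))

    -- The meet clauses use the order alone, the join clauses join-primeness, and the complement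
    -- clause that an atom is below exactly one of `x` and `∁ x`.
    τ-isHomomorphism : IsCompleteModalHomomorphism raw (G (F κ A)) (τ κ A)
    τ-isHomomorphism = record
      { cong   = τ-cong
      ; ∨-homo = τ-∨-homo
      ; ∧-homo = λ x y →
          (λ a≤x∧y → τ-mono (x∧y≤x x y) a≤x∧y , τ-mono (x∧y≤y x y) a≤x∧y) ,
          λ (lift a≤x , lift a≤y) → lift (∧-greatest a≤x a≤y)
      ; ∁-homo = λ _ →
          (λ { {_ , a-atom} (lift a≤∁x) (lift a≤x) → ≤∁⇒≰ a-atom a≤∁x a≤x }) ,
          λ { {_ , a-atom} a≰x → lift (≰⇒atom≤∁ a-atom (a≰x ∘ lift)) }
      ; ⊤-homo = _ , λ _ → lift (maximum _)
      ; ⊥-homo = (λ { {_ , a-atom} (lift a≤⊥) → ⊥-elim (atom-≰⊥ a-atom a≤⊥) }) , λ ()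
      ; ⋁-homo = λ X isJoin →
          (λ (_ , x∈X , Y≤τx , _) a∈Y → τ-mono (proj₁ isJoin x∈X) (Y≤τx a∈Y)) ,
          λ { _ ub {_ , a-atom} (lift a≤s) →
            let x , x∈X , a≤x = atom-join-prime a-atom isJoin a≤s
            in ub {τᴬ x} (x , x∈X , id , id) {_ , a-atom} (lift a≤x) }
      ; ⋀-homo = λ X isMeet →
          (λ (_ , x∈X , _ , τx≤Y) a≤m → τx≤Y (τ-mono (proj₁ isMeet x∈X) a≤m)) ,
          λ _ lb {a} a∈L → lift (proj₂ isMeet _ λ {x} x∈X →
            lower (lb {τᴬ x} (x , x∈X , id , id) {a} a∈L))
      ; ◇-homo = τ-◇-homo
      }

    τ-isIsomorphism : IsCompleteModalIsomorphism raw (G (F κ A)) (τ κ A)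
    τ-isIsomorphism = record
      { isHomomorphism = τ-isHomomorphism
      ; bijective =
          (λ (τx≤τy , τy≤τx) → antisym (τ-cancel-≤ (λ {a} → τx≤τy {a})) (τ-cancel-≤ (λ {a} → τy≤τx {a}))) ,
          strictlySurjective⇒surjective base G.base {f = τᴬ} τ-cong τ-strictlySurjective
      }

    -- Additivity is transported from A along the surjection τ, as it can fail in G of a general frame.
    ◇ᴳ-∨ : ∀ Y Z → G.◇ (Y G.∨ Z) G.≈ G.◇ Y G.∨ G.◇ Z
    ◇ᴳ-∨ Y Z with τ-strictlySurjective Y | τ-strictlySurjective Z
    ... | y , τy≈Y | z , τz≈Z = begin
      G.◇ (Y G.∨ Z)            ≈⟨ ◇ᴳ-cong {τᴬ y G.∨ τᴬ z} {Y G.∨ Z} (∨-cong (τᴬ y) Y (τᴬ z) Z τy≈Y τz≈Z) ⟨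
      G.◇ (τᴬ y G.∨ τᴬ z)      ≈⟨ ◇ᴳ-cong {τᴬ (y ∨ z)} {τᴬ y G.∨ τᴬ z} (τ-∨-homo y z) ⟨
      G.◇ (τᴬ (y ∨ z))         ≈⟨ τ-◇-homo (y ∨ z) ⟨
      τᴬ (◇ (y ∨ z))           ≈⟨ τ-cong (◇-∨ y z) ⟩
      τᴬ (◇ y ∨ ◇ z)           ≈⟨ τ-∨-homo (◇ y) (◇ z) ⟩
      τᴬ (◇ y) G.∨ τᴬ (◇ z)    ≈⟨ ∨-cong (τᴬ (◇ y)) (G.◇ (τᴬ y)) (τᴬ (◇ z)) (G.◇ (τᴬ z)) (τ-◇-homo y) (τ-◇-homo z) ⟩
      G.◇ (τᴬ y) G.∨ G.◇ (τᴬ z)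
        ≈⟨ ∨-cong (G.◇ (τᴬ y)) (G.◇ Y) (G.◇ (τᴬ z)) (G.◇ Z)
             (◇ᴳ-cong {τᴬ y} {Y} τy≈Y) (◇ᴳ-cong {τᴬ z} {Z} τz≈Z) ⟩
      G.◇ Y G.∨ G.◇ Z          ∎
      where
      open import Relation.Binary.Reasoning.Setoid G.base
      ∨-cong : ∀ V V′ W W′ → V G.≈ V′ → W G.≈ W′ → V G.∨ W G.≈ V′ G.∨ W′
      ∨-cong _ _ _ _ (f , f′) (g , g′) = [ inj₁ ∘ f , inj₂ ∘ g ] , [ inj₁ ∘ f′ , inj₂ ∘ g′ ]

    G-isCompleteModalAlgebra : IsCompleteModalAlgebra (G (F κ A))
    G-isCompleteModalAlgebra = record
      { isBooleanAlgebra = Powerset.isBooleanAlgebra (F κ A)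
      ; ◇-cong = λ {Y} {Z} → ◇ᴳ-cong {Y} {Z}
      ; ◇-⊥    =
          -- An intersection over no relations would be everything, so some relation must be
          -- exhibited; that of `｛ ⊥ ｝` will do, as its preimage of the empty set is empty.
          (λ a∈◇⊥ → ⊥-elim (case a∈◇⊥ (R ｛ ⊥ ｝)
            (｛ ⊥ ｝ , ｛｝-∣< κ ⊥ , λ _ _ → ⇔-id _) of λ ())) ,
          λ ()
      ; ◇-∨    = ◇ᴳ-∨
      ; joins  = Powerset.joins (F κ A)
      ; meets  = Powerset.meets (F κ A)
      }

    -- The two inclusions behind `τ-◇-homo`, now indexed by small subsets instead of by relations up
    -- to equivalence.
    atomsBelow-◇ : ∀ x → atomsBelow κ A (◇ x) ≐
                   ⋂[ X ∶ Σ[ Y ∈ 𝒫 ] ∣ Y ∣< κ ] (R (proj₁ X) ⁻¹[ atomsBelow κ A x ])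
    atomsBelow-◇ x =
      (λ {a} a≤◇x (X , ∣X∣<κ) → ≤◇⇒R κ additive X ∣X∣<κ {a} a≤◇x) ,
      λ {a} a∈⋂ → R｛｝⇒≤◇ κ {a = a} (a∈⋂ (｛ x ｝ , ｛｝-∣< κ x))

theorem9p2 : (∀ {ℓ} → ExcludedMiddle ℓ) →
    ∀ {c ℓ₁ ℓ₂ k} (κ : RegularCardinal k) (A : CompleteModalAlgebra c ℓ₁ ℓ₂) →
    let open CompleteModalAlgebra A in
    Additive κ → Atomic →
    IsCompleteModalAlgebra (G (F κ A)) ×
    IsCompleteModalIsomorphism raw (G (F κ A)) (τ κ A) ×
    (∀ x → atomsBelow κ A (◇ x) ≐ ⋂[ X ∶ Σ[ Y ∈ 𝒫 ] ∣ Y ∣< κ ] (R (proj₁ X) ⁻¹[ atomsBelow κ A x ]))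
theorem9p2 em κ A additive atomic =
  G-isCompleteModalAlgebra , τ-isIsomorphism , atomsBelow-◇
  where open Classical.Representation em κ A additive atomic
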